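{- For any integers $k\geq 1$ and $m\geq 2$, the graph $C_{4k}\times P_m$ admits a $4(2m-1)$-divisible graceful $\alpha$-labeling.
   Context: $C_n$ ($n\ge 3$) is the cycle on $n$ vertices and $P_m$ ($m\ge 2$) is the path on $m$ vertices. $C_n\times P_m$ denotes their Cartesian product (the grid on a cylinder): its vertices are the pairs $(i,j)$ with $1\le i\le m$, $1\le j\le n$, and its edges are $[(i,j),(i,j+1)]$ (with $j$ taken modulo $n$) for $1\le i\le m$, and $[(i,j),(i+1,j)]$ for $1\le i\le m-1$. The graph $C_{4k}\times P_m$ is bipartite and has $4k(2m-1)$ edges. The size of a graph is its number of edges. Let $\Gamma$ be a graph of size $e=d\cdot q$ with $d,q$ positive integers. A $d$-divisible graceful labeling of $\Gamma$ is an injective function $f:V(\Gamma)\to\{0,1,2,\ldots,d(q+1)-1\}$ such that $$\{|f(x)-f(y)| : [x,y]\in E(\Gamma)\}=\{1,2,3,\ldots,d(q+1)\}\setminus\{q+1,2(q+1),\ldots,d(q+1)\}.$$ If $\Gamma$ is bipartite, a $d$-divisible graceful $\alpha$-labeling of $\Gamma$ is a $d$-divisible graceful labeling $f$ of $\Gamma$ such that the maximum value of $f$ on one of the two bipartite sets is strictly less than its minimum value on the other one. -}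

module Defs where

open import Data.Bool.Base using (Bool; not)
open import Data.Fin.Base using (Fin; toℕ)
open import Data.Fin.Properties using (toℕ<n)
open import Data.Nat.Base
open import Data.Nat.DivMod using (_%_; m<n⇒m%n≡m; n%n≡0)
open import Data.Nat.Properties
  using (m≤n⇒m<n∨m≡n; 1+n≢n; <-irrefl; ≤-trans; *-monoʳ-≤; n≤1+n)
open import Data.Product.Base using (∃-syntax; _×_; _,_)
open import Data.Sum.Base using (_⊎_; inj₁; inj₂)
open import Function.Bundles using (Bijection; _⇔_)
open import Function.Definitions using (Injective)
open import Level using (0ℓ)
open import Relation.Binary.Bundles using (Setoid)
open import Relation.Binary.Construct.Closure.Symmetric as Sym using (SymClosure; fwd; bwd)
open import Relation.Binary.Core using (Rel)
open import Relation.Binary.Definitions using (Symmetric; Irreflexive)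
open import Relation.Binary.PropositionalEquality
  using (_≡_; _≢_; refl; sym; trans; cong; setoid)
open import Relation.Nullary.Negation using (¬_)

record Graph : Set₁ where
  field
    Vertex : Set
    Adj    : Rel Vertex 0ℓ
    adj-sym    : Symmetric Adj
    adj-irrefl : Irreflexive _≡_ Adj

open Graph public

-- An undirected edge [x,y] is an adjacent ordered pair, identified with its
-- reversal; the proof of adjacency is ignored.
edgeSetoid : Graph → Setoid 0ℓ 0ℓ
edgeSetoid Γ = record
  { Carrier = ∃[ x ] ∃[ y ] Adj Γ x y
  ; _≈_     = λ { (x , y , _) (x′ , y′ , _) → (x ≡ x′ × y ≡ y′) ⊎ (x ≡ y′ × y ≡ x′) }
  ; isEquivalence = record
    { refl  = inj₁ (refl , refl)
    ; sym   = λ { (inj₁ (refl , refl)) → inj₁ (refl , refl)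
                ; (inj₂ (refl , refl)) → inj₂ (refl , refl) }
    ; trans = λ { (inj₁ (refl , refl)) q                    → q
                ; (inj₂ (refl , refl)) (inj₁ (refl , refl)) → inj₂ (refl , refl)
                ; (inj₂ (refl , refl)) (inj₂ (refl , refl)) → inj₁ (refl , refl) }
    }
  }

HasSize : Graph → ℕ → Set
HasSize Γ e = Bijection (setoid (Fin e)) (edgeSetoid Γ)

-- Vertices of cycles and paths are numbered from 0.

path : ℕ → Graph
path m = record
  { Vertex     = Fin m
  ; Adj        = SymClosure (λ i j → toℕ j ≡ suc (toℕ i))
  ; adj-sym    = Sym.symmetric _
  ; adj-irrefl = λ { refl (fwd p) → 1+n≢n (sym p) ; refl (bwd p) → 1+n≢n (sym p) }
  }

cycle : (n : ℕ) → 3 ≤ n → Graph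
cycle n 3≤n = record
  { Vertex     = Fin n
  ; Adj        = SymClosure (λ i j → toℕ j ≡ suc (toℕ i) % n)
  ; adj-sym    = Sym.symmetric _
  ; adj-irrefl = λ { {i} refl (fwd p) → noLoop i p ; {i} refl (bwd p) → noLoop i p }
  }
  where
  instance
    n≢0 : NonZero n
    n≢0 = >-nonZero (≤-trans (s≤s z≤n) 3≤n)

  noLoop : (i : Fin n) → ¬ (toℕ i ≡ suc (toℕ i) % n)
  noLoop i p with m≤n⇒m<n∨m≡n (toℕ<n i)
  ... | inj₁ 1+i<n = 1+n≢n (sym (trans p (m<n⇒m%n≡m 1+i<n)))
  ... | inj₂ 1+i≡n = <-irrefl 1≡n (≤-trans (s≤s (s≤s z≤n)) 3≤n)
    where
    i≡0 : toℕ i ≡ 0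
    i≡0 = trans p (trans (cong (_% n) 1+i≡n) (n%n≡0 n))
    1≡n : 1 ≡ n
    1≡n = trans (cong suc (sym i≡0)) 1+i≡n

infixr 6 _□_

-- The Cartesian product of graphs.
_□_ : Graph → Graph → Graph
Γ □ Δ = record
  { Vertex     = Vertex Γ × Vertex Δ
  ; Adj        = λ { (x , y) (x′ , y′) → (Adj Γ x x′ × y ≡ y′) ⊎ (x ≡ x′ × Adj Δ y y′) }
  ; adj-sym    = λ { (inj₁ (a , e)) → inj₁ (adj-sym Γ a , sym e)
                   ; (inj₂ (e , a)) → inj₂ (sym e , adj-sym Δ a) }
  ; adj-irrefl = λ { refl (inj₁ (a , _)) → adj-irrefl Γ refl a
                   ; refl (inj₂ (_ , a)) → adj-irrefl Δ refl a }
  }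

3≤4*k : ∀ {k} → 1 ≤ k → 3 ≤ 4 * k
3≤4*k 1≤k = ≤-trans (n≤1+n 3) (*-monoʳ-≤ 4 1≤k)

record DivisibleGracefulLabeling (Γ : Graph) (d : ℕ) : Set where
  field
    q        : ℕ
    d-pos    : 1 ≤ d
    q-pos    : 1 ≤ q
    size     : HasSize Γ (d * q)
    f        : Vertex Γ → ℕ
    f-range  : ∀ x → f x ≤ d * (q + 1) ∸ 1
    f-inj    : Injective _≡_ _≡_ f
    f-diffs  : ∀ t →
      (∃[ x ] ∃[ y ] (Adj Γ x y × ∣ f x - f y ∣ ≡ t))
        ⇔
      ((1 ≤ t × t ≤ d * (q + 1)) × ¬ (∃[ i ] (1 ≤ i × i ≤ d × t ≡ i * (q + 1))))

-- The two bipartite sets are the fibres of side.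
record Bipartition (Γ : Graph) : Set where
  field
    side   : Vertex Γ → Bool
    proper : ∀ {x y} → Adj Γ x y → side x ≢ side y

IsMaximumOn : {V : Set} → (V → Set) → (V → ℕ) → ℕ → Set
IsMaximumOn P f a = (∃[ x ] (P x × f x ≡ a)) × (∀ x → P x → f x ≤ a)

IsMinimumOn : {V : Set} → (V → Set) → (V → ℕ) → ℕ → Set
IsMinimumOn P f b = (∃[ x ] (P x × f x ≡ b)) × (∀ x → P x → b ≤ f x)

record DivisibleGracefulαLabeling (Γ : Graph) (d : ℕ) : Set where
  field
    labeling    : DivisibleGracefulLabeling Γ d
    bipartition : Bipartition Γ
  open DivisibleGracefulLabeling labeling
  open Bipartition bipartition
  field
    separated : ∃[ s ] ∃[ a ] ∃[ b ]
      (IsMaximumOn (λ x → side x ≡ s) f a × IsMinimumOn (λ x → side x ≡ not s) f b × a < b)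

{-# OPTIONS --safe #-}
module Submission where

-- Write n = 4k, let v = i + j (mod n) at column j of layer i, call the vertex
-- low or high according to the parity of v, and let e = d(k + 1) - 1.  A low
-- vertex gets its offset as label, a high one e minus its offset, so that an
-- edge of offset sum s has difference e - s.  The differences are correct when
-- the P-th edge (P < dk) has offset sum P + ⌊P / k⌋: these sums are the numbers
-- below d(k + 1) whose residue modulo k + 1 is not k.  The offset
-- 4(k + 1) i + weight v achieves this as soon as the weights label the single
-- cycle C_n in this manner, because in the coordinates (v , i) the edges between
-- layers i and i + 1 also join v to v + 1, so that they copy the edges of the
-- cycle with the summand 4(k + 1) 2i replaced by 4(k + 1) (2i + 1).

open import Defs
open import Data.Nat.Base using (ℕ; _≤_; _*_; _∸_)
open import Data.Bool.Base using (Bool; true; false; not)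
open import Data.Bool.Properties using (not-involutive; not-injective; not-¬)
open import Data.Fin.Base using (Fin; toℕ; fromℕ<)
open import Data.Fin.Properties using (toℕ<n; toℕ-fromℕ<; toℕ-injective)
open import Data.Nat.Base hiding (ℕ; _≤_; _*_; _∸_)
open import Data.Nat.DivMod
open import Data.Nat.Divisibility using (divides-refl)
open import Data.Nat.Properties
open import Data.Nat.Tactic.RingSolver using (solve-∀)
open import Data.Product.Base using (∃-syntax; _×_; _,_; proj₁; proj₂; map₂)
open import Data.Sum.Base using (_⊎_; inj₁; inj₂; [_,_]′)
open import Function.Bundles using (mk⇔)
open import Relation.Binary.Bundles using (Setoid)
open import Relation.Binary.Construct.Closure.Symmetric using (fwd; bwd)
open import Relation.Binary.Definitions using (tri<; tri≈; tri>)
open import Relation.Binary.PropositionalEquality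
  using (_≡_; _≢_; refl; sym; trans; cong; cong₂; subst; subst₂; module ≡-Reasoning)
open import Relation.Nullary.Decidable.Core using (yes; no)
open import Relation.Nullary.Negation using (¬_; contradiction)

-- Parity.

isEven : ℕ → Bool
isEven zero    = true
isEven (suc v) = not (isEven v)

isEven-double : ∀ v → isEven (2 * v) ≡ true
isEven-double zero    = refl
isEven-double (suc v) = trans (cong (λ z → not (isEven z)) (+-suc v (v + 0)))
  (trans (not-involutive _) (isEven-double v))

even⇒double : ∀ v → isEven v ≡ true → ∃[ t ] v ≡ 2 * t
even⇒double zero          _ = 0 , refl
even⇒double (suc (suc v)) e with even⇒double v (trans (sym (not-involutive _)) e)
... | t , refl = suc t , cong suc (sym (+-suc t (t + 0)))

sameParity⇒double : ∀ {v w} → v ≤ w → isEven v ≡ isEven w → ∃[ t ] w ≡ 2 * t + v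
sameParity⇒double {w = w} z≤n e with even⇒double w (sym e)
... | t , refl = t , sym (+-identityʳ _)
sameParity⇒double (s≤s le) e with sameParity⇒double le (not-injective e)
... | t , refl = t , sym (+-suc (2 * t) _)

-- Step and pulse functions, and the vertex weights built from them.

step : ℕ → ℕ → ℕ
step zero    v       = 1
step (suc t) zero    = 0
step (suc t) (suc v) = step t v

step-≥ : ∀ {t v} → t ≤ v → step t v ≡ 1
step-≥ z≤n      = refl
step-≥ (s≤s le) = step-≥ le

step-< : ∀ {t v} → v < t → step t v ≡ 0
step-< {suc t} {zero}  _        = refl
step-< {suc t} {suc v} (s≤s lt) = step-< lt

-- The indicator of "t ≤ v and v has the parity of t".
pulse : ℕ → ℕ → ℕ
pulse zero    zero          = 1
pulse zero    (suc zero)    = 0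
pulse zero    (suc (suc v)) = pulse zero v
pulse (suc t) zero          = 0
pulse (suc t) (suc v)       = pulse t v

-- Exactly one of two consecutive numbers has the parity of `t`, and when `suc v` equals `t` that
-- one is `suc v`. So the parity condition drops out of the sum.
pulse-sum : ∀ t v → pulse t v + pulse t (suc v) ≡ step t (suc v)
pulse-sum zero          zero          = refl
pulse-sum zero          (suc zero)    = refl
pulse-sum zero          (suc (suc v)) = pulse-sum zero v
pulse-sum (suc zero)    zero          = refl
pulse-sum (suc (suc t)) zero          = refl
pulse-sum (suc t)       (suc v)       = pulse-sum t v

pulse-mono : ∀ t v → pulse t v ≤ pulse t (2 + v)
pulse-mono zero          v       = ≤-refl
pulse-mono (suc t)       zero    = z≤n
pulse-mono (suc t)       (suc v) = pulse-mono t v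

pulse-shift : ∀ t v → pulse t (t + v) ≡ pulse 0 v
pulse-shift zero    v = refl
pulse-shift (suc t) v = pulse-shift t v

pulse-even : ∀ t v → pulse 0 (2 * t + v) ≡ pulse 0 v
pulse-even zero    v = refl
pulse-even (suc t) v =
  trans (cong (λ z → pulse 0 (suc z + v)) (+-suc t (t + 0))) (pulse-even t v)

-- The weight ⌊v / 2⌋ of the path is bumped at the vertices k + 1, 2k and 3k, once
-- for each multiple of k + 1 to be skipped; the second bump at 2k makes room for
-- the closing edge.
weight : ℕ → ℕ → ℕ
weight k v = ⌊ v /2⌋ + (pulse (suc k) v + (2 * pulse (2 * k) v + pulse (3 * k) v))

-- A bump recurs at every second later vertex, so it raises the sum of every later edge by the same
-- constant. The halves add up to `v` because `⌊ suc v /2⌋` is `⌈ v /2⌉`.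
weight-sum : ∀ k v → weight k v + weight k (suc v) ≡
  v + (step (suc k) (suc v) + (2 * step (2 * k) (suc v) + step (3 * k) (suc v)))
weight-sum k v = trans
  (regroup ⌊ v /2⌋ ⌈ v /2⌉ (pulse (suc k) v) (pulse (suc k) (suc v))
    (pulse (2 * k) v) (pulse (2 * k) (suc v)) (pulse (3 * k) v) (pulse (3 * k) (suc v)))
  (cong₂ _+_ (⌊n/2⌋+⌈n/2⌉≡n v)
    (cong₂ _+_ (pulse-sum (suc k) v)
      (cong₂ (λ y z → 2 * y + z) (pulse-sum (2 * k) v) (pulse-sum (3 * k) v))))
  where
  regroup : ∀ a a′ b b′ c c′ d d′ →
    (a + (b + (2 * c + d))) + (a′ + (b′ + (2 * c′ + d′))) ≡
    (a + a′) + ((b + b′) + (2 * (c + c′) + (d + d′)))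
  regroup = solve-∀

-- Pulses alternate, so monotonicity is claimed only within a parity class. This suffices for
-- injectivity, because vertices of opposite parity get their labels in disjoint ranges.
weight-step : ∀ k v → weight k v < weight k (2 + v)
weight-step k v = s≤s (+-monoʳ-≤ ⌊ v /2⌋ (+-mono-≤ (pulse-mono (suc k) v)
  (+-mono-≤ (*-monoʳ-≤ 2 (pulse-mono (2 * k) v)) (pulse-mono (3 * k) v))))

weight-grows : ∀ k t v → t + weight k v ≤ weight k (2 * t + v)
weight-grows k zero    v = ≤-refl
weight-grows k (suc t) v = ≤-trans (s≤s (weight-grows k t v))
  (subst (λ z → weight k (2 * t + v) < weight k (suc z + v)) (sym (+-suc t (t + 0)))
    (weight-step k (2 * t + v)))

weight-mono : ∀ k {v w} → v ≤ w → isEven v ≡ isEven w → weight k v ≤ weight k w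
weight-mono k {v} le e with sameParity⇒double le e
... | t , refl = ≤-trans (m≤n+m _ t) (weight-grows k t v)

weight-mono-< : ∀ k {v w} → v < w → isEven v ≡ isEven w → weight k v < weight k w
weight-mono-< k {v} lt e with sameParity⇒double (<⇒≤ lt) e
... | zero  , refl = contradiction lt (<-irrefl refl)
... | suc t , refl = ≤-trans (s≤s (m≤n+m _ t)) (weight-grows k (suc t) v)

weight-injective : ∀ k {v w} → isEven v ≡ isEven w → weight k v ≡ weight k w → v ≡ w
weight-injective k {v} {w} e eq with <-cmp v w
... | tri< lt _ _ = contradiction eq (<⇒≢ (weight-mono-< k lt e))
... | tri≈ _ v≡w _ = v≡w
... | tri> _ _ gt = contradiction (sym eq) (<⇒≢ (weight-mono-< k gt (sym e)))

weight-first : ∀ k .{{_ : NonZero k}} → weight k 0 ≡ 0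
weight-first (suc j) = refl

-- The half contributes 2k - 1. The vertex 4k - 1 is odd, so the pulse at 2k misses it, while k + 1
-- and 3k have opposite parities, so exactly one of their pulses hits it.
weight-last : ∀ k .{{_ : NonZero k}} → weight k (pred (4 * k)) ≡ 2 * k
weight-last k@(suc j) = trans
  (cong₂ _+_ halves (cong₂ _+_ first (cong₂ (λ y z → 2 * y + z) second third)))
  (trans (cong (λ z → suc (2 * j) + z)
    (trans (+-comm (pulse 0 (suc j)) (pulse 0 j)) (pulse-sum 0 j))) (finish j))
  where
  finish : ∀ j → suc (2 * j) + 1 ≡ 2 * suc j
  finish = solve-∀
  eq₀ : ∀ j → j + 3 * suc j ≡ suc (suc (2 * j) + suc (2 * j))
  eq₀ = solve-∀
  eq₁ : ∀ j → j + 3 * suc j ≡ suc (suc j) + (2 * j + suc j)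
  eq₁ = solve-∀
  eq₂ : ∀ j → j + 3 * suc j ≡ 2 * suc j + (2 * j + 1)
  eq₂ = solve-∀
  eq₃ : ∀ j → j + 3 * suc j ≡ 3 * suc j + j
  eq₃ = solve-∀
  halves : ⌊ pred (4 * k) /2⌋ ≡ suc (2 * j)
  halves = trans (cong ⌊_/2⌋ (eq₀ j)) (sym (n≡⌈n+n/2⌉ (suc (2 * j))))
  first : pulse (suc k) (pred (4 * k)) ≡ pulse 0 (suc j)
  first = trans (cong (pulse (suc k)) (eq₁ j))
    (trans (pulse-shift (suc k) _) (pulse-even j (suc j)))
  second : pulse (2 * k) (pred (4 * k)) ≡ 0
  second = trans (cong (pulse (2 * k)) (eq₂ j)) (trans (pulse-shift (2 * k) _) (pulse-even j 1))
  third : pulse (3 * k) (pred (4 * k)) ≡ pulse 0 j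
  third = trans (cong (pulse (3 * k)) (eq₃ j)) (pulse-shift (3 * k) j)

/-unique : ∀ {p} b k .{{_ : NonZero k}} → b * k ≤ p → p < suc b * k → p / k ≡ b
/-unique {p} b k le lt =
  ≤-antisym (s≤s⁻¹ (m<n*o⇒m/o<n lt)) (subst (_≤ p / k) (m*n/n≡m b k) (/-monoˡ-≤ k le))

-- The edges of the cycle in order of weight.

module Cycle (k : ℕ) .{{_ : NonZero k}} where

  n : ℕ
  n = 4 * k

  instance
    n≢0 : NonZero n
    n≢0 = m*n≢0 4 k

  -- Listing the edges [v , v + 1] of the cycle by increasing weight puts the
  -- closing edge [n - 1 , 0], of weight 2k, between those at 2k - 2 and 2k - 1.
  edgeAt : ℕ → ℕ
  edgeAt p with <-cmp (suc p) (2 * k)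
  ... | tri< _ _ _ = p
  ... | tri≈ _ _ _ = pred n
  ... | tri> _ _ _ = pred p

  edgeAt-below : ∀ {p} → suc p < 2 * k → edgeAt p ≡ p
  edgeAt-below {p} lt with <-cmp (suc p) (2 * k)
  ... | tri< _ _ _ = refl
  ... | tri≈ ≮ _ _ = contradiction lt ≮
  ... | tri> ≮ _ _ = contradiction lt ≮

  edgeAt-middle : ∀ {p} → suc p ≡ 2 * k → edgeAt p ≡ pred n
  edgeAt-middle {p} eq with <-cmp (suc p) (2 * k)
  ... | tri< _ ≢ _ = contradiction eq ≢
  ... | tri≈ _ _ _ = refl
  ... | tri> _ ≢ _ = contradiction eq ≢

  edgeAt-above : ∀ {p} → 2 * k < suc p → edgeAt p ≡ pred p
  edgeAt-above {p} gt with <-cmp (suc p) (2 * k)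
  ... | tri< _ _ ≯ = contradiction gt ≯
  ... | tri≈ _ _ ≯ = contradiction gt ≯
  ... | tri> _ _ _ = refl

  pred-n<n : pred n < n
  pred-n<n = ≤-reflexive (suc-pred n)

  edgeAt-< : ∀ {p} → p < n → edgeAt p < n
  edgeAt-< {p} p<n with <-cmp (suc p) (2 * k)
  ... | tri< _ _ _ = p<n
  ... | tri≈ _ _ _ = pred-n<n
  ... | tri> _ _ _ = ≤-<-trans pred[n]≤n p<n

  edgeAt-surjective : ∀ {v} → v < n → ∃[ p ] (p < n × edgeAt p ≡ v)
  edgeAt-surjective {v} v<n with suc v <? 2 * k | suc v <? n
  ... | yes lt | _ = v , v<n , edgeAt-below lt
  ... | no ≮ | yes lt = suc v , lt , edgeAt-above (s≤s (≮⇒≥ ≮))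
  ... | no ≮ | no ≥n = pred (2 * k) , ≤-<-trans (pred-mono-≤ (*-monoˡ-≤ k 2≤4)) pred-n<n ,
      trans (edgeAt-middle (suc-pred (2 * k) {{m*n≢0 2 k}})) (sym v≡)
    where
    2≤4 : 2 ≤ 4
    2≤4 = s≤s (s≤s z≤n)
    v≡ : v ≡ pred n
    v≡ = cong pred (≤-antisym v<n (≮⇒≥ ≥n))

  -- Before position 2k - 1 only the bump at k + 1 counts, and it reaches the edge [p , p + 1] from
  -- p = k on. The closing edge has sum 2k at position 2k - 1. After it, position p holds the edge
  -- starting at p - 1, and the first two bumps contribute three: one makes up for the lag, two give
  -- the quotient, which the bump at 3k raises to three.
  edgeAt-weight : ∀ {p} → p < n →
    weight k (edgeAt p) + weight k (suc (edgeAt p) % n) ≡ p + p / k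
  edgeAt-weight {p} p<n with <-cmp (suc p) (2 * k)
  ... | tri< lt _ _ = begin
      weight k p + weight k (suc p % n)
        ≡⟨ cong (λ z → weight k p + weight k z) (m<n⇒m%n≡m (<-≤-trans lt (*-monoˡ-≤ k 2≤4))) ⟩
      weight k p + weight k (suc p)
        ≡⟨ weight-sum k p ⟩
      p + (step k p + (2 * step (2 * k) (suc p) + step (3 * k) (suc p)))
        ≡⟨ cong₂ (λ y z → p + (step k p + (2 * y + z))) (step-< lt)
             (step-< (<-≤-trans lt (*-monoˡ-≤ k 2≤3))) ⟩
      p + (step k p + 0)
        ≡⟨ cong (p +_) (trans (+-identityʳ _) (sym quotient)) ⟩
      p + p / k ∎
    where
    open ≡-Reasoning
    2≤3 : 2 ≤ 3
    2≤3 = s≤s (s≤s z≤n)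
    2≤4 : 2 ≤ 4
    2≤4 = s≤s (s≤s z≤n)
    quotient : p / k ≡ step k p
    quotient with p <? k
    ... | yes p<k = trans (m<n⇒m/n≡0 p<k) (sym (step-< p<k))
    ... | no  p≮k = trans
      (/-unique 1 k (≤-trans (≤-reflexive (*-identityˡ k)) (≮⇒≥ p≮k)) (<-trans (n<1+n p) lt))
      (sym (step-≥ (≮⇒≥ p≮k)))
  ... | tri≈ _ eq _ = begin
      weight k (pred n) + weight k (suc (pred n) % n)
        ≡⟨ cong₂ _+_ (weight-last k)
             (cong (weight k) (trans (cong (_% n) (suc-pred n)) (n%n≡0 n))) ⟩
      2 * k + weight k 0
        ≡⟨ cong₂ _+_ (sym eq) (weight-first k) ⟩
      suc p + 0
        ≡⟨ +-suc p 0 ⟨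
      p + 1
        ≡⟨ cong (p +_) (/-unique 1 k k≤p (≤-reflexive eq)) ⟨
      p + p / k ∎
    where
    open ≡-Reasoning
    k≤p : 1 * k ≤ p
    k≤p = s≤s⁻¹ (subst (1 * k <_) (sym eq) (*-monoˡ-< k {1} {2} (s≤s (s≤s z≤n))))
  edgeAt-weight {suc p} p<n | tri> _ _ (s≤s ge) = begin
      weight k p + weight k (suc p % n)
        ≡⟨ cong (λ z → weight k p + weight k z) (m<n⇒m%n≡m p<n) ⟩
      weight k p + weight k (suc p)
        ≡⟨ weight-sum k p ⟩
      p + (step (suc k) (suc p) + (2 * step (2 * k) (suc p) + step (3 * k) (suc p)))
        ≡⟨ cong₂ (λ y z → p + (y + (2 * z + step (3 * k) (suc p))))
             (step-≥ k<p) (step-≥ ge) ⟩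
      p + (3 + step (3 * k) (suc p))
        ≡⟨ +-suc p _ ⟩
      suc p + (2 + step (3 * k) (suc p))
        ≡⟨ cong (suc p +_) quotient ⟨
      suc p + suc p / k ∎
    where
    open ≡-Reasoning
    k<p : suc k ≤ suc p
    k<p = <-≤-trans (m<m+n k (≤-trans (>-nonZero⁻¹ k) (m≤m+n k 0))) ge
    quotient : suc p / k ≡ 2 + step (3 * k) (suc p)
    quotient with suc p <? 3 * k
    ... | yes lt = trans (/-unique 2 k ge lt) (cong (2 +_) (sym (step-< lt)))
    ... | no  ≮ = trans (/-unique 3 k (≮⇒≥ ≮) p<n) (cong (2 +_) (sym (step-≥ (≮⇒≥ ≮))))
  edgeAt-weight {zero} _ | tri> _ _ (s≤s ge) =
    contradiction (n≤0⇒n≡0 {2 * k} ge) (≢-nonZero⁻¹ (2 * k) {{m*n≢0 2 k}})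

-- Remainders, halves, and the sums P + ⌊P / k⌋.

%-congˡ-+ : ∀ {a b} c n .{{_ : NonZero n}} → a % n ≡ b % n → (a + c) % n ≡ (b + c) % n
%-congˡ-+ {a} {b} c n eq = trans (%-distribˡ-+ a c n)
  (trans (cong (λ z → (z + c % n) % n) eq) (sym (%-distribˡ-+ b c n)))

%-remove-inner : ∀ a c n .{{_ : NonZero n}} → (a % n + c) % n ≡ (a + c) % n
%-remove-inner a c n = %-congˡ-+ {a % n} {a} c n (m%n%n≡m%n a n)

suc-%-remove-inner : ∀ a n .{{_ : NonZero n}} → suc (a % n) % n ≡ suc a % n
suc-%-remove-inner a n = trans (cong (_% n) (+-comm 1 (a % n)))
  (trans (%-remove-inner a 1 n) (cong (_% n) (+-comm a 1)))

⌈n/2⌉-cases : ∀ l → ⌈ l /2⌉ ≡ ⌊ l /2⌋ ⊎ ⌈ l /2⌉ ≡ suc ⌊ l /2⌋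
⌈n/2⌉-cases zero          = inj₁ refl
⌈n/2⌉-cases (suc zero)    = inj₂ refl
⌈n/2⌉-cases (suc (suc l)) =
  [ (λ e → inj₁ (cong suc e)) , (λ e → inj₂ (cong suc e)) ]′ (⌈n/2⌉-cases l)

-- Recovers the layers of the ends of an arc from their sum: 2i stands for layer i itself, 2i + 1
-- for the passage from layer i to layer i + 1.
halves : ∀ {a b} → b ≡ a ⊎ b ≡ suc a → ⌊ a + b /2⌋ ≡ a × ⌈ a + b /2⌉ ≡ b
halves {a} (inj₁ refl) = sym (n≡⌊n+n/2⌋ a) , sym (n≡⌈n+n/2⌉ a)
halves {a} (inj₂ refl) =
    trans (cong ⌊_/2⌋ (+-suc a a)) (sym (n≡⌈n+n/2⌉ a))
  , trans (cong ⌈_/2⌉ (+-suc a a)) (cong suc (sym (n≡⌊n+n/2⌋ a)))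

-- Adding the quotient rereads the pair (quotient, remainder) with radix k + 1 in place of k. The
-- remainder stays below k, so the residue k never occurs.
sum-decode : ∀ k P .{{_ : NonZero k}} → P + P / k ≡ P % k + (P / k) * (k + 1)
sum-decode k P = trans (cong (_+ P / k) (m≡m%n+[m/n]*n P k)) (regroup (P % k) (P / k) k)
  where
  regroup : ∀ r b k → r + b * k + b ≡ r + b * (k + 1)
  regroup = solve-∀

sum-mono-< : ∀ k .{{_ : NonZero k}} {P Q} → P < Q → P + P / k < Q + Q / k
sum-mono-< k lt = +-mono-<-≤ lt (/-monoˡ-≤ k (<⇒≤ lt))

sum-injective : ∀ k .{{_ : NonZero k}} {P Q} → P + P / k ≡ Q + Q / k → P ≡ Q
sum-injective k {P} {Q} eq with <-cmp P Q
... | tri< lt _ _ = contradiction eq (<⇒≢ (sum-mono-< k lt))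
... | tri≈ _ P≡Q _ = P≡Q
... | tri> _ _ gt = contradiction (sym eq) (<⇒≢ (sum-mono-< k gt))

-- The cylinder in rotated coordinates.

module Cylinder (k M d : ℕ) .{{_ : NonZero k}} (3≤n : 3 ≤ 4 * k)
  (d≡ : d ≡ 4 * suc (M + M)) where

  open Cycle k

  Γ : Graph
  Γ = cycle (4 * k) 3≤n □ path (suc M)

  V : Set
  V = Fin n × Fin (suc M)

  layer : V → ℕ
  layer (_ , i) = toℕ i

  rotated : V → ℕ
  rotated (j , i) = (toℕ j + toℕ i) % n

  -- The inverse of (`rotated` , `layer`): modulo `n`, adding `i * pred n` amounts to subtracting
  -- `i`, without truncation.
  vertex : ℕ → Fin (suc M) → V
  vertex v i = fromℕ< (m%n<n (v + toℕ i * pred n) n) , i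

  complete : ∀ v i → v + i + i * pred n ≡ v + i * n
  complete v i = trans (+-assoc v i _)
    (cong (v +_) (trans (sym (*-suc i (pred n))) (cong (i *_) (suc-pred n))))

  rotated-vertex : ∀ {v} i → v < n → rotated (vertex v i) ≡ v
  rotated-vertex {v} i v<n = begin
    (toℕ (fromℕ< (m%n<n (v + a * pred n) n)) + a) % n
      ≡⟨ cong (λ z → (z + a) % n) (toℕ-fromℕ< (m%n<n (v + a * pred n) n)) ⟩
    ((v + a * pred n) % n + a) % n
      ≡⟨ %-remove-inner (v + a * pred n) a n ⟩
    (v + a * pred n + a) % n
      ≡⟨ cong (_% n) (swap v (a * pred n) a) ⟩
    (v + a + a * pred n) % n
      ≡⟨ cong (_% n) (complete v a) ⟩
    (v + a * n) % n
      ≡⟨ [m+kn]%n≡m%n v a n ⟩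
    v % n
      ≡⟨ m<n⇒m%n≡m v<n ⟩
    v ∎
    where
    open ≡-Reasoning
    a = toℕ i
    swap : ∀ x y z → x + y + z ≡ x + z + y
    swap = solve-∀

  column : (x : V) → toℕ (proj₁ x) ≡ (rotated x + layer x * pred n) % n
  column (j , i) = sym (begin
    ((toℕ j + a) % n + a * pred n) % n ≡⟨ %-remove-inner (toℕ j + a) (a * pred n) n ⟩
    (toℕ j + a + a * pred n) % n       ≡⟨ cong (_% n) (complete (toℕ j) a) ⟩
    (toℕ j + a * n) % n                ≡⟨ [m+kn]%n≡m%n (toℕ j) a n ⟩
    toℕ j % n                          ≡⟨ m<n⇒m%n≡m (toℕ<n j) ⟩
    toℕ j                              ∎)
    where
    open ≡-Reasoning
    a = toℕ i

  coordinates-injective : ∀ {x y} → rotated x ≡ rotated y → layer x ≡ layer y → x ≡ y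
  coordinates-injective {x} {y} r l = cong₂ _,_
    (toℕ-injective (trans (column x)
      (trans (cong₂ (λ v i → (v + i * pred n) % n) r l) (sym (column y)))))
    (toℕ-injective l)

  -- In rotated coordinates both kinds of edges advance one step along the
  -- cycle, within a layer or from one layer to the next.
  Arc : V → V → Set
  Arc x y = rotated y ≡ suc (rotated x) % n × (layer y ≡ layer x ⊎ layer y ≡ suc (layer x))

  next-column : ∀ {j j′} i → toℕ j′ ≡ suc (toℕ j) % n →
    rotated (j′ , i) ≡ suc (rotated (j , i)) % n
  next-column {j} {j′} i p = begin
    (toℕ j′ + toℕ i) % n            ≡⟨ cong (λ z → (z + toℕ i) % n) p ⟩
    (suc (toℕ j) % n + toℕ i) % n   ≡⟨ %-remove-inner (suc (toℕ j)) (toℕ i) n ⟩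
    suc (toℕ j + toℕ i) % n         ≡⟨ suc-%-remove-inner (toℕ j + toℕ i) n ⟨
    suc ((toℕ j + toℕ i) % n) % n   ∎
    where open ≡-Reasoning

  next-layer : ∀ j {i i′ : Fin (suc M)} → toℕ i′ ≡ suc (toℕ i) →
    rotated (j , i′) ≡ suc (rotated (j , i)) % n
  next-layer j {i} {i′} p = begin
    (toℕ j + toℕ i′) % n            ≡⟨ cong (λ z → (toℕ j + z) % n) p ⟩
    (toℕ j + suc (toℕ i)) % n       ≡⟨ cong (_% n) (+-suc (toℕ j) (toℕ i)) ⟩
    suc (toℕ j + toℕ i) % n         ≡⟨ suc-%-remove-inner (toℕ j + toℕ i) n ⟨
    suc ((toℕ j + toℕ i) % n) % n   ∎
    where open ≡-Reasoning

  adj⇒arc : ∀ {x y} → Adj Γ x y → Arc x y ⊎ Arc y x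
  adj⇒arc {j , i} {j′ , _} (inj₁ (fwd p , refl)) = inj₁ (next-column {j} {j′} i p , inj₁ refl)
  adj⇒arc {j , i} {j′ , _} (inj₁ (bwd p , refl)) = inj₂ (next-column {j′} {j} i p , inj₁ refl)
  adj⇒arc {j , i} {_ , i′} (inj₂ (refl , fwd p)) = inj₁ (next-layer j {i} {i′} p , inj₂ p)
  adj⇒arc {j , i} {_ , i′} (inj₂ (refl , bwd p)) = inj₂ (next-layer j {i′} {i} p , inj₂ p)

  -- Undoing the rotation leaves the step along the cycle visible within a layer. Between layers one
  -- more `pred n` is added, which with the step makes a full turn, so the column is unchanged.
  arc⇒adj : ∀ {x y} → Arc x y → Adj Γ x y
  arc⇒adj {x@(j , i)} {y@(j′ , i′)} (r , inj₁ l) = inj₁ (fwd advance , sym (toℕ-injective l))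
    where
    open ≡-Reasoning
    advance : toℕ j′ ≡ suc (toℕ j) % n
    advance = begin
      toℕ j′
        ≡⟨ column y ⟩
      (rotated y + toℕ i′ * pred n) % n
        ≡⟨ cong₂ (λ v a → (v + a * pred n) % n) r l ⟩
      (suc (rotated x) % n + toℕ i * pred n) % n
        ≡⟨ %-remove-inner (suc (rotated x)) (toℕ i * pred n) n ⟩
      suc (rotated x + toℕ i * pred n) % n
        ≡⟨ suc-%-remove-inner (rotated x + toℕ i * pred n) n ⟨
      suc ((rotated x + toℕ i * pred n) % n) % n
        ≡⟨ cong (λ z → suc z % n) (column x) ⟨
      suc (toℕ j) % n ∎
  arc⇒adj {x@(j , i)} {y@(j′ , i′)} (r , inj₂ l) = inj₂ (sym (toℕ-injective (begin
    toℕ j′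
      ≡⟨ column y ⟩
    (rotated y + toℕ i′ * pred n) % n
      ≡⟨ cong₂ (λ v a → (v + a * pred n) % n) r l ⟩
    (suc (rotated x) % n + suc (toℕ i) * pred n) % n
      ≡⟨ %-remove-inner (suc (rotated x)) (suc (toℕ i) * pred n) n ⟩
    suc (rotated x + (pred n + toℕ i * pred n)) % n
      ≡⟨ cong (_% n) (regroup (rotated x) (pred n) (toℕ i * pred n)) ⟩
    (rotated x + toℕ i * pred n + suc (pred n)) % n
      ≡⟨ cong (λ z → (rotated x + toℕ i * pred n + z) % n) (suc-pred n) ⟩
    (rotated x + toℕ i * pred n + n) % n
      ≡⟨ [m+n]%n≡m%n (rotated x + toℕ i * pred n) n ⟩
    (rotated x + toℕ i * pred n) % n
      ≡⟨ column x ⟨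
    toℕ j ∎)) , fwd l)
    where
    open ≡-Reasoning
    regroup : ∀ a b c → suc (a + (b + c)) ≡ a + c + suc b
    regroup = solve-∀

  -- Numbering of the edges of the cylinder.

  size≡ : d * k ≡ suc (M + M) * n
  size≡ = trans (cong (_* k) d≡) (regroup (suc (M + M)) k)
    where
    regroup : ∀ l k → 4 * l * k ≡ l * (4 * k)
    regroup = solve-∀

  -- The edges form 2M + 1 copies of the cycle, `n` edges each. Copy `l` joins layer `⌊ l /2⌋` to
  -- layer `⌈ l /2⌉`, and `p` is the position within the copy.
  module Edge (P : Fin (d * k)) where

    l p : ℕ
    l = toℕ P / n
    p = toℕ P % n

    l≤ : l ≤ M + M
    l≤ = s≤s⁻¹ (m<n*o⇒m/o<n {n = suc (M + M)} (subst (toℕ P <_) size≡ (toℕ<n P)))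

    lower< : ⌊ l /2⌋ < suc M
    lower< = s≤s (subst (⌊ l /2⌋ ≤_) (sym (n≡⌊n+n/2⌋ M)) (⌊n/2⌋-mono l≤))

    upper< : ⌈ l /2⌉ < suc M
    upper< = s≤s (subst (⌈ l /2⌉ ≤_) (sym (n≡⌈n+n/2⌉ M)) (⌈n/2⌉-mono l≤))

    source target : V
    source = vertex (edgeAt p) (fromℕ< lower<)
    target = vertex (suc (edgeAt p) % n) (fromℕ< upper<)

    rotated-source : rotated source ≡ edgeAt p
    rotated-source = rotated-vertex (fromℕ< lower<) (edgeAt-< (m%n<n (toℕ P) n))

    rotated-target : rotated target ≡ suc (edgeAt p) % n
    rotated-target = rotated-vertex (fromℕ< upper<) (m%n<n (suc (edgeAt p)) n)

    arc : Arc source target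
    arc = trans rotated-target (cong (λ z → suc z % n) (sym rotated-source)) ,
      subst₂ (λ a b → b ≡ a ⊎ b ≡ suc a)
        (sym (toℕ-fromℕ< lower<)) (sym (toℕ-fromℕ< upper<)) (⌈n/2⌉-cases l)

  open Edge using (source; target; arc)

  edges-cover : ∀ {x y} → Arc x y → ∃[ P ] (source P ≡ x × target P ≡ y)
  edges-cover {x} {y} (r , h) = P ,
      coordinates-injective
        (trans (Edge.rotated-source P) edgeAt-p)
        (trans (toℕ-fromℕ< (Edge.lower< P)) (trans (cong ⌊_/2⌋ l≡) (proj₁ (halves h)))) ,
      coordinates-injective
        (trans (Edge.rotated-target P) (trans (cong (λ z → suc z % n) edgeAt-p) (sym r)))
        (trans (toℕ-fromℕ< (Edge.upper< P)) (trans (cong ⌈_/2⌉ l≡) (proj₂ (halves h))))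
    where
    position = edgeAt-surjective (m%n<n (toℕ (proj₁ x) + layer x) n)
    p = proj₁ position
    p<n = proj₁ (proj₂ position)
    l = layer x + layer y
    l< : l < suc (M + M)
    l< = s≤s (+-mono-≤ (s≤s⁻¹ (toℕ<n (proj₂ x))) (s≤s⁻¹ (toℕ<n (proj₂ y))))
    next : l * n + p < suc l * n
    next = subst (l * n + p <_) (+-comm (l * n) n) (+-monoʳ-< (l * n) p<n)
    bound : l * n + p < d * k
    bound = subst (l * n + p <_) (sym size≡) (<-≤-trans next (*-monoˡ-≤ n l<))
    P = fromℕ< bound
    l≡ : toℕ P / n ≡ l
    l≡ = trans (cong (_/ n) (toℕ-fromℕ< bound)) (/-unique l n (m≤m+n _ p) next)
    p≡ : toℕ P % n ≡ p
    p≡ = trans (cong (_% n) (trans (toℕ-fromℕ< bound) (+-comm (l * n) p)))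
      (trans ([m+kn]%n≡m%n p l n) (m<n⇒m%n≡m p<n))
    edgeAt-p : edgeAt (toℕ P % n) ≡ rotated x
    edgeAt-p = trans (cong edgeAt p≡) (proj₂ (proj₂ position))

  -- Offsets and their sums along edges.

  offset : V → ℕ
  offset x = 4 * (k + 1) * layer x + weight k (rotated x)

  -- Each full copy of the cycle raises P by 4k and ⌊P / k⌋ by 4, hence their sum by 4(k + 1), which
  -- is the offset of one layer. The rest is `edgeAt-weight`.
  offset-edge : ∀ P → offset (source P) + offset (target P) ≡ toℕ P + toℕ P / k
  offset-edge P = begin
    4 * (k + 1) * layer (source P) + weight k (rotated (source P)) +
      (4 * (k + 1) * layer (target P) + weight k (rotated (target P)))
      ≡⟨ regroup (k + 1) (layer (source P)) _ (layer (target P)) _ ⟩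
    4 * (k + 1) * (layer (source P) + layer (target P)) +
      (weight k (rotated (source P)) + weight k (rotated (target P)))
      ≡⟨ cong₂ (λ y z → 4 * (k + 1) * y + z) layers weights ⟩
    4 * (k + 1) * l + (p + p / k)
      ≡⟨ collect k l p (p / k) ⟩
    (p + l * n) + (4 * l + p / k)
      ≡⟨ cong₂ _+_ (sym (m≡m%n+[m/n]*n (toℕ P) n)) (sym quotient) ⟩
    toℕ P + toℕ P / k ∎
    where
    open ≡-Reasoning
    open Edge P using (l; p; lower<; upper<; rotated-source; rotated-target)
    regroup : ∀ c a s b t → 4 * c * a + s + (4 * c * b + t) ≡ 4 * c * (a + b) + (s + t)
    regroup = solve-∀
    collect : ∀ k l p b → 4 * (k + 1) * l + (p + b) ≡ (p + l * (4 * k)) + (4 * l + b)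
    collect = solve-∀
    layers : layer (source P) + layer (target P) ≡ l
    layers = trans (cong₂ _+_ (toℕ-fromℕ< lower<) (toℕ-fromℕ< upper<)) (⌊n/2⌋+⌈n/2⌉≡n l)
    weights : weight k (rotated (source P)) + weight k (rotated (target P)) ≡ p + p / k
    weights = trans (cong₂ (λ y z → weight k y + weight k z) rotated-source rotated-target)
      (edgeAt-weight (m%n<n (toℕ P) n))
    multiple : ∀ k l p → p + l * (4 * k) ≡ 4 * l * k + p
    multiple = solve-∀
    quotient : toℕ P / k ≡ 4 * l + p / k
    quotient = begin
      toℕ P / k               ≡⟨ cong (_/ k) (m≡m%n+[m/n]*n (toℕ P) n) ⟩
      (p + l * n) / k         ≡⟨ cong (_/ k) (multiple k l p) ⟩
      (4 * l * k + p) / k     ≡⟨ +-distrib-/-∣ˡ p (divides-refl (4 * l)) ⟩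
      4 * l * k / k + p / k   ≡⟨ cong (_+ p / k) (m*n/n≡m (4 * l) k) ⟩
      4 * l + p / k           ∎

-- The two sides and the largest offset on each.

module Labelling (k M d e : ℕ) .{{_ : NonZero k}} (3≤n : 3 ≤ 4 * k)
  (d≡ : d ≡ 4 * suc (M + M)) (suc-e : suc e ≡ d * (k + 1)) where
  open Cycle k
  open Cylinder k M d 3≤n d≡
  open Edge using (source; target; arc)

  side : V → Bool
  side x = isEven (rotated x)

  isEven-n : isEven n ≡ true
  isEven-n = trans (cong isEven (*-assoc 2 2 k)) (isEven-double (2 * k))

  -- Parity survives the wrap-around because `n` is even, like 0.
  isEven-suc-% : ∀ {v} → v < n → isEven (suc v % n) ≡ isEven (suc v)
  isEven-suc-% {v} v<n with m≤n⇒m<n∨m≡n v<n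
  ... | inj₁ lt = cong isEven (m<n⇒m%n≡m lt)
  ... | inj₂ eq = trans (cong isEven (trans (cong (_% n) eq) (n%n≡0 n)))
                    (sym (trans (cong isEven eq) isEven-n))

  rotated<n : ∀ x → rotated x < n
  rotated<n (j , i) = m%n<n (toℕ j + toℕ i) n

  side-arc : ∀ {x y} → Arc x y → side y ≡ not (side x)
  side-arc {x} (r , _) = trans (cong isEven r) (isEven-suc-% (rotated<n x))

  last : Bool → ℕ
  last true  = pred (pred n)
  last false = pred n

  2k<n : 2 * k < n
  2k<n = *-monoˡ-< k {2} {4} (s≤s (s≤s (s≤s z≤n)))

  pred-n≢0 : NonZero (pred n)
  pred-n≢0 = >-nonZero (<-≤-trans (≤-trans (>-nonZero⁻¹ k) (m≤m+n k (k + 0))) (<⇒≤pred 2k<n))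

  suc-last : suc (last true) ≡ last false
  suc-last = suc-pred (pred n) {{pred-n≢0}}

  isEven-last : ∀ b → isEven (last b) ≡ b
  isEven-last false = not-injective (trans (cong isEven (suc-pred n)) isEven-n)
  isEven-last true  = not-injective (trans (cong isEven suc-last) (isEven-last false))

  last<n : ∀ b → last b < n
  last<n true  = ≤-<-trans pred[n]≤n pred-n<n
  last<n false = pred-n<n

  ≤-last : ∀ {v} b → v < n → isEven v ≡ b → v ≤ last b
  ≤-last false v<n _ = <⇒≤pred v<n
  ≤-last true  v<n even with m≤n⇒m<n∨m≡n (<⇒≤pred v<n)
  ... | inj₁ lt   = <⇒≤pred lt
  ... | inj₂ refl with () ← trans (sym even) (isEven-last false)

  -- The last two vertices span the edge in the last position `pred n`, where the quotient by `k` is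
  -- 3.
  weights-last : weight k (last true) + weight k (last false) ≡ pred n + 3
  weights-last = begin
    weight k (last true) + weight k (last false)
      ≡⟨ cong₂ (λ y z → weight k y + weight k z) (sym at-end)
           (sym (trans (cong (λ z → suc z % n) at-end)
             (trans (cong (_% n) suc-last) (m<n⇒m%n≡m pred-n<n)))) ⟩
    weight k (edgeAt (pred n)) + weight k (suc (edgeAt (pred n)) % n)
      ≡⟨ edgeAt-weight pred-n<n ⟩
    pred n + pred n / k
      ≡⟨ cong (pred n +_) (/-unique 3 k (<⇒≤pred 3k<n) pred-n<n) ⟩
    pred n + 3 ∎
    where
    open ≡-Reasoning
    at-end : edgeAt (pred n) ≡ last true
    at-end = edgeAt-above (subst (2 * k <_) (sym (suc-pred n)) 2k<n)
    3k<n : 3 * k < n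
    3k<n = *-monoˡ-< k {3} {4} (s≤s (s≤s (s≤s (s≤s z≤n))))

  cap : Bool → ℕ
  cap b = 4 * (k + 1) * M + weight k (last b)

  -- Makes the largest low label and the smallest high label consecutive, so the two sides are
  -- separated with nothing to spare.
  caps : suc (cap true + cap false) ≡ e
  caps = suc-injective (begin
    2 + (cap true + cap false)
      ≡⟨ regroup (4 * (k + 1) * M) (weight k (last true)) (weight k (last false)) ⟩
    4 * (k + 1) * M + 4 * (k + 1) * M + (2 + (weight k (last true) + weight k (last false)))
      ≡⟨ cong (λ z → 4 * (k + 1) * M + 4 * (k + 1) * M + (2 + z)) weights-last ⟩
    4 * (k + 1) * M + 4 * (k + 1) * M + (2 + (pred n + 3))
      ≡⟨ collect k M (pred n) ⟩
    4 * (k + 1) * M + 4 * (k + 1) * M + (suc (pred n) + 4)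
      ≡⟨ cong (λ z → 4 * (k + 1) * M + 4 * (k + 1) * M + (z + 4)) (suc-pred n) ⟩
    4 * (k + 1) * M + 4 * (k + 1) * M + (4 * k + 4)
      ≡⟨ factor k M ⟩
    4 * suc (M + M) * (k + 1)
      ≡⟨ cong (_* (k + 1)) d≡ ⟨
    d * (k + 1)
      ≡⟨ suc-e ⟨
    suc e ∎)
    where
    open ≡-Reasoning
    regroup : ∀ a s t → 2 + (a + s + (a + t)) ≡ a + a + (2 + (s + t))
    regroup = solve-∀
    collect : ∀ k M p → 4 * (k + 1) * M + 4 * (k + 1) * M + (2 + (p + 3)) ≡
      4 * (k + 1) * M + 4 * (k + 1) * M + (suc p + 4)
    collect = solve-∀
    factor : ∀ k M → 4 * (k + 1) * M + 4 * (k + 1) * M + (4 * k + 4) ≡ 4 * suc (M + M) * (k + 1)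
    factor = solve-∀

  cap<e : ∀ b → cap b < e
  cap<e true  = subst (cap true <_) caps (s≤s (m≤m+n (cap true) (cap false)))
  cap<e false = subst (cap false <_) caps (s≤s (m≤n+m (cap false) (cap true)))

  opposite-caps : ∀ b → cap b + cap (not b) < e
  opposite-caps true  = ≤-reflexive caps
  opposite-caps false = ≤-reflexive (trans (cong suc (+-comm (cap false) (cap true))) caps)

  offset-≤ : ∀ x → offset x ≤ cap (side x)
  offset-≤ x = +-mono-≤ (*-monoʳ-≤ (4 * (k + 1)) (s≤s⁻¹ (toℕ<n (proj₂ x))))
    (weight-mono k (≤-last (side x) (rotated<n x) refl) (sym (isEven-last (side x))))

  offset-≤e : ∀ x → offset x ≤ e
  offset-≤e x = ≤-trans (offset-≤ x) (<⇒≤ (cap<e (side x)))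

  -- Labels and their differences along edges.

  label : Bool → ℕ → ℕ
  label true  o = o
  label false o = e ∸ o

  f : V → ℕ
  f x = label (side x) (offset x)

  label-≤ : ∀ b o → o ≤ e → label b o ≤ e
  label-≤ true  o le = le
  label-≤ false o _  = m∸n≤m e o

  label-injective : ∀ b {o o′} → o ≤ e → o′ ≤ e → label b o ≡ label b o′ → o ≡ o′
  label-injective true  _  _   eq = eq
  label-injective false le le′ eq = ∸-cancelˡ-≡ le le′ eq

  low<high : ∀ o o′ → o + o′ < e → label true o < label false o′
  low<high o o′ lt = m+n≤o⇒m≤o∸n (suc o) lt

  label-difference : ∀ b {o o′} → o + o′ < e → ∣ label b o - label (not b) o′ ∣ ≡ e ∸ (o + o′)
  label-difference true {o} {o′} lt = begin
    ∣ o - e ∸ o′ ∣   ≡⟨ m≤n⇒∣m-n∣≡n∸m (<⇒≤ (low<high o o′ lt)) ⟩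
    e ∸ o′ ∸ o       ≡⟨ ∸-+-assoc e o′ o ⟩
    e ∸ (o′ + o)     ≡⟨ cong (e ∸_) (+-comm o′ o) ⟩
    e ∸ (o + o′)     ∎
    where open ≡-Reasoning
  label-difference false {o} {o′} lt = begin
    ∣ e ∸ o - o′ ∣   ≡⟨ m≤n⇒∣n-m∣≡n∸m (<⇒≤ (low<high o′ o (subst (_< e) (+-comm o o′) lt))) ⟩
    e ∸ o ∸ o′       ≡⟨ ∸-+-assoc e o o′ ⟩
    e ∸ (o + o′)     ∎
    where open ≡-Reasoning

  offset-sum< : ∀ {x y} → side y ≡ not (side x) → offset x + offset y < e
  offset-sum< {x} {y} s = ≤-<-trans
    (+-mono-≤ (offset-≤ x) (subst (λ b → offset y ≤ cap b) s (offset-≤ y)))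
    (opposite-caps (side x))

  sum : Fin (d * k) → ℕ
  sum P = toℕ P + toℕ P / k

  sum<e : ∀ P → sum P < e
  sum<e P = subst (_< e) (offset-edge P)
    (offset-sum< {source P} {target P} (side-arc {source P} {target P} (arc P)))

  edge-difference : ∀ P → ∣ f (source P) - f (target P) ∣ ≡ e ∸ sum P
  edge-difference P = begin
    ∣ f (source P) - label (side (target P)) (offset (target P)) ∣
      ≡⟨ cong (λ b → ∣ f (source P) - label b (offset (target P)) ∣) opposite ⟩
    ∣ f (source P) - label (not (side (source P))) (offset (target P)) ∣
      ≡⟨ label-difference (side (source P)) (offset-sum< {source P} {target P} opposite) ⟩
    e ∸ (offset (source P) + offset (target P))
      ≡⟨ cong (e ∸_) (offset-edge P) ⟩
    e ∸ sum P ∎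
    where
    open ≡-Reasoning
    opposite : side (target P) ≡ not (side (source P))
    opposite = side-arc {source P} {target P} (arc P)

  edges-cover-adj : ∀ {x y} → Adj Γ x y →
    ∃[ P ] ((source P ≡ x × target P ≡ y) ⊎ (source P ≡ y × target P ≡ x))
  edges-cover-adj {x} {y} a = [ (λ xy → map₂ inj₁ (edges-cover {x} {y} xy))
                              , (λ yx → map₂ inj₂ (edges-cover {y} {x} yx)) ]′ (adj⇒arc {x} {y} a)

  difference-realised : ∀ {x y} → Adj Γ x y → ∃[ P ] ∣ f x - f y ∣ ≡ e ∸ sum P
  difference-realised {x} {y} a = map₂ (λ {P} → along P) (edges-cover-adj {x} {y} a)
    where
    along : ∀ P → (source P ≡ x × target P ≡ y) ⊎ (source P ≡ y × target P ≡ x) →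
      ∣ f x - f y ∣ ≡ e ∸ sum P
    along P (inj₁ (s , t)) =
      trans (sym (cong₂ (λ v w → ∣ f v - f w ∣) s t)) (edge-difference P)
    along P (inj₂ (s , t)) = trans (∣-∣-comm (f x) (f y))
      (trans (sym (cong₂ (λ v w → ∣ f v - f w ∣) s t)) (edge-difference P))

  -- The number of edges.

  difference-injective : ∀ {P Q} →
    ∣ f (source P) - f (target P) ∣ ≡ ∣ f (source Q) - f (target Q) ∣ → P ≡ Q
  difference-injective {P} {Q} eq = toℕ-injective (sum-injective k
    (∸-cancelˡ-≡ (<⇒≤ (sum<e P)) (<⇒≤ (sum<e Q))
      (trans (sym (edge-difference P)) (trans eq (edge-difference Q)))))

  adjacent : ∀ P → Adj Γ (source P) (target P)
  adjacent P = arc⇒adj {source P} {target P} (arc P)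

  -- The labelling itself excludes repetitions: the absolute difference is invariant under reversal
  -- of an edge and determines the edge number.
  hasSize : HasSize Γ (d * k)
  hasSize = record
    { to        = λ P → source P , target P , adjacent P
    ; cong      = λ { refl → inj₁ (refl , refl) }
    ; bijective = injective , surjective
    }
    where
    open Setoid (edgeSetoid Γ) using (_≈_)
    injective : ∀ {P Q} →
      (source P , target P , adjacent P) ≈ (source Q , target Q , adjacent Q) → P ≡ Q
    injective {P} {Q} (inj₁ (s , t)) =
      difference-injective {P} {Q} (cong₂ (λ x y → ∣ f x - f y ∣) s t)
    injective {P} {Q} (inj₂ (s , t)) = difference-injective {P} {Q}
      (trans (cong₂ (λ x y → ∣ f x - f y ∣) s t) (∣-∣-comm (f (target Q)) (f (source Q))))
    surjective : ∀ xy → ∃[ P ] (∀ {Q} → Q ≡ P → (source Q , target Q , adjacent Q) ≈ xy)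
    surjective (x , y , a) = map₂ (λ eqs → λ { refl → eqs }) (edges-cover-adj {x} {y} a)

  -- Injectivity of the labelling.

  same-side : ∀ o o′ b c → (c ≡ not b → o + o′ < e) → label b o ≡ label c o′ → b ≡ c
  same-side o o′ true  true  _ _ = refl
  same-side o o′ false false _ _ = refl
  same-side o o′ true  false lt eq = contradiction eq (<⇒≢ (low<high o o′ (lt refl)))
  same-side o o′ false true  lt eq =
    contradiction (sym eq) (<⇒≢ (low<high o′ o (subst (_< e) (+-comm o o′) (lt refl))))

  -- A label determines the side by separation, then the offset. Weights are below 4(k + 1), so the
  -- layer is the quotient of the offset by that number, and the remaining weight determines the
  -- rotated coordinate within its parity class.
  f-injective : ∀ {x y} → f x ≡ f y → x ≡ y
  f-injective {x} {y} eq = coordinates-injective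
      (weight-injective k sides (+-cancelˡ-≡ (4 * (k + 1) * layer x) _ _
        (trans offsets (cong (λ a → 4 * (k + 1) * a + weight k (rotated y)) (sym layers)))))
      layers
    where
    sides : side x ≡ side y
    -- `offset-sum<` bounds the sum of two offsets only for opposite sides, hence the conditional
    -- argument.
    sides = same-side (offset x) (offset y) (side x) (side y)
      (λ s → offset-sum< {x} {y} s) eq
    offsets : offset x ≡ offset y
    offsets = label-injective (side x) (offset-≤e x) (offset-≤e y)
      (trans eq (cong (λ b → label b (offset y)) (sym sides)))
    instance
      c≢0 : NonZero (4 * (k + 1))
      c≢0 = m*n≢0 4 (k + 1) {{_}} {{>-nonZero (m≤n+m 1 k)}}
    weight< : ∀ x → weight k (rotated x) < 4 * (k + 1)
    weight< x = ≤-<-trans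
      (weight-mono k (≤-last (side x) (rotated<n x) refl) (sym (isEven-last (side x))))
      (≤-<-trans (last-≤ (side x)) total<)
      where
      last-≤ : ∀ b → weight k (last b) ≤ weight k (last true) + weight k (last false)
      last-≤ true  = m≤m+n (weight k (last true)) _
      last-≤ false = m≤n+m (weight k (last false)) (weight k (last true))
      total< : weight k (last true) + weight k (last false) < 4 * (k + 1)
      total< = ≤-trans
        (≤-reflexive (trans (cong suc weights-last) (cong (_+ 3) (suc-pred n))))
        (≤-trans (n≤1+n (n + 3)) (≤-reflexive (shift k)))
        where
        shift : ∀ k → suc (4 * k + 3) ≡ 4 * (k + 1)
        shift = solve-∀
    layer-offset : ∀ x → offset x / (4 * (k + 1)) ≡ layer x
    layer-offset x = trans
      (cong (λ z → (z + weight k (rotated x)) / (4 * (k + 1))) (*-comm (4 * (k + 1)) (layer x)))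
      (/-unique (layer x) (4 * (k + 1)) (m≤m+n _ _)
        (subst (layer x * (4 * (k + 1)) + weight k (rotated x) <_)
          (+-comm (layer x * (4 * (k + 1))) _)
          (+-monoʳ-< (layer x * (4 * (k + 1))) (weight< x))))
    layers : layer x ≡ layer y
    layers = trans (sym (layer-offset x)) (trans (cong (_/ (4 * (k + 1))) offsets) (layer-offset y))

  -- The set of differences.

  1≤d : 1 ≤ d
  1≤d = subst (1 ≤_) (sym d≡) (s≤s z≤n)

  k+1≢0 : NonZero (k + 1)
  k+1≢0 = >-nonZero (m≤n+m 1 k)

  -- Since `suc e` is a multiple of k + 1, the difference e - s is one only if s + 1 is, that is, if
  -- s has residue k. By `sum-decode` the residue of `sum P` is below k.
  difference-in-range : ∀ P → (1 ≤ e ∸ sum P × e ∸ sum P ≤ d * (k + 1)) ×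
    ¬ (∃[ i ] (1 ≤ i × i ≤ d × e ∸ sum P ≡ i * (k + 1)))
  difference-in-range P =
    (m<n⇒0<n∸m (sum<e P) , ≤-trans (m∸n≤m e (sum P)) (≤-trans (n≤1+n e) (≤-reflexive suc-e))) ,
    not-multiple
    where
    open ≡-Reasoning
    instance _ = k+1≢0
    r = toℕ P % k
    b = toℕ P / k
    suc-r< : suc r < k + 1
    suc-r< = subst (suc r <_) (+-comm 1 k) (s≤s (m%n<n (toℕ P) k))
    regroup : ∀ i r b c → suc (i * c + (r + b * c)) ≡ suc r + (i + b) * c
    regroup = solve-∀
    not-multiple : ¬ (∃[ i ] (1 ≤ i × i ≤ d × e ∸ sum P ≡ i * (k + 1)))
    not-multiple (i , _ , _ , eq) = contradiction (begin
      suc r                                  ≡⟨ m<n⇒m%n≡m suc-r< ⟨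
      suc r % (k + 1)                        ≡⟨ [m+kn]%n≡m%n (suc r) (i + b) (k + 1) ⟨
      (suc r + (i + b) * (k + 1)) % (k + 1)  ≡⟨ cong (_% (k + 1)) (regroup i r b (k + 1)) ⟨
      suc (i * (k + 1) + (r + b * (k + 1))) % (k + 1)
        ≡⟨ cong (λ z → suc z % (k + 1)) (cong₂ _+_ (sym eq) (sym (sum-decode k (toℕ P)))) ⟩
      suc (e ∸ sum P + sum P) % (k + 1)
        ≡⟨ cong (λ z → suc z % (k + 1)) (m∸n+n≡m (<⇒≤ (sum<e P))) ⟩
      suc e % (k + 1)                        ≡⟨ cong (_% (k + 1)) suc-e ⟩
      d * (k + 1) % (k + 1)                  ≡⟨ m*n%n≡0 d (k + 1) ⟩
      0                                      ∎) λ ()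

  -- Inverts `sum-decode`: the quotient and remainder of e - t by k + 1 become those of P by k,
  -- provided that the remainder is not k.
  range-covered : ∀ t → 1 ≤ t → t ≤ d * (k + 1) →
    ¬ (∃[ i ] (1 ≤ i × i ≤ d × t ≡ i * (k + 1))) → ∃[ P ] e ∸ sum P ≡ t
  range-covered t 1≤t t≤ not-multiple = P , trans (cong (e ∸_) sum-P) (m∸[m∸n]≡n t≤e)
    where
    instance _ = k+1≢0
    t≤e : t ≤ e
    t≤e with m≤n⇒m<n∨m≡n t≤
    ... | inj₁ lt = s≤s⁻¹ (subst (t <_) (sym suc-e) lt)
    -- The value d(k + 1), the only one in the range above `e`, is itself an excluded multiple.
    ... | inj₂ eq = contradiction (d , 1≤d , ≤-refl , eq) not-multiple
    s = e ∸ t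
    b = s / (k + 1)
    r = s % (k + 1)
    s≡ : s ≡ r + b * (k + 1)
    s≡ = m≡m%n+[m/n]*n s (k + 1)
    b<d : b < d
    b<d = m<n*o⇒m/o<n (subst (s <_) suc-e (s≤s (m∸n≤m e t)))
    r≢k : r ≢ k
    -- With remainder k, s + 1 is (b + 1)(k + 1), so t = `suc e` - (s + 1) is the multiple by d - (b
    -- + 1). The factor is positive because t is.
    r≢k r≡k = not-multiple (d ∸ suc b , positive , m∸n≤m d (suc b) , t≡)
      where
      open ≡-Reasoning
      t≡ : t ≡ (d ∸ suc b) * (k + 1)
      t≡ = sym (begin
        (d ∸ suc b) * (k + 1)               ≡⟨ *-distribʳ-∸ (k + 1) d (suc b) ⟩
        d * (k + 1) ∸ suc b * (k + 1)       ≡⟨ cong₂ _∸_ (sym suc-e) (regroup b k) ⟩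
        e ∸ (k + b * (k + 1))               ≡⟨ cong (λ z → e ∸ (z + b * (k + 1))) r≡k ⟨
        e ∸ (r + b * (k + 1))               ≡⟨ cong (e ∸_) s≡ ⟨
        e ∸ s                               ≡⟨ m∸[m∸n]≡n t≤e ⟩
        t                                   ∎)
        where
        regroup : ∀ b k → suc b * (k + 1) ≡ suc (k + b * (k + 1))
        regroup = solve-∀
      positive : 1 ≤ d ∸ suc b
      positive with d ∸ suc b in eq
      ... | suc _ = s≤s z≤n
      ... | zero  = contradiction (trans t≡ (cong (_* (k + 1)) eq)) (>⇒≢ 1≤t)
    r<k : r < k
    r<k = ≤∧≢⇒< (s≤s⁻¹ (subst (r <_) (+-comm k 1) (m%n<n s (k + 1)))) r≢k
    next : b * k + r < suc b * k
    next = subst (b * k + r <_) (+-comm (b * k) k) (+-monoʳ-< (b * k) r<k)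
    bound : b * k + r < d * k
    bound = <-≤-trans next (*-monoˡ-≤ k b<d)
    P = fromℕ< bound
    sum-P : sum P ≡ s
    sum-P = begin
      toℕ P + toℕ P / k            ≡⟨ cong (λ z → z + z / k) (toℕ-fromℕ< bound) ⟩
      b * k + r + (b * k + r) / k  ≡⟨ cong (b * k + r +_) (/-unique b k (m≤m+n _ r) next) ⟩
      b * k + r + b                ≡⟨ regroup b k r ⟩
      r + b * (k + 1)              ≡⟨ s≡ ⟨
      s                            ∎
      where
      open ≡-Reasoning
      regroup : ∀ b k r → b * k + r + b ≡ r + b * (k + 1)
      regroup = solve-∀

  -- Extreme labels and separation of the two sides.

  top : Bool → V
  top b = vertex (last b) (fromℕ< (n<1+n M))

  side-top : ∀ b → side (top b) ≡ b
  side-top b = trans (cong isEven (rotated-vertex (fromℕ< (n<1+n M)) (last<n b))) (isEven-last b)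

  offset-top : ∀ b → offset (top b) ≡ cap b
  offset-top b = cong₂ (λ a v → 4 * (k + 1) * a + weight k v)
    (toℕ-fromℕ< (n<1+n M)) (rotated-vertex (fromℕ< (n<1+n M)) (last<n b))

  f-top : ∀ b → f (top b) ≡ label b (cap b)
  f-top b = cong₂ label (side-top b) (offset-top b)

  labeling : DivisibleGracefulLabeling Γ d
  labeling = record
    { q       = k
    ; d-pos   = 1≤d
    ; q-pos   = >-nonZero⁻¹ k
    ; size    = hasSize
    ; f       = f
    ; f-range = λ x → subst (f x ≤_) (cong pred suc-e) (label-≤ (side x) (offset x) (offset-≤e x))
    ; f-inj   = f-injective
    ; f-diffs = λ t → mk⇔ (differences-allowed t) (differences-attained t)
    }
    where
    Allowed : ℕ → Set
    Allowed t = (1 ≤ t × t ≤ d * (k + 1)) × ¬ (∃[ i ] (1 ≤ i × i ≤ d × t ≡ i * (k + 1)))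
    differences-allowed : ∀ t → ∃[ x ] ∃[ y ] (Adj Γ x y × ∣ f x - f y ∣ ≡ t) → Allowed t
    differences-allowed t (x , y , a , eq) =
      subst Allowed (trans (sym (proj₂ realised)) eq) (difference-in-range (proj₁ realised))
      where realised = difference-realised {x} {y} a
    differences-attained : ∀ t → Allowed t → ∃[ x ] ∃[ y ] (Adj Γ x y × ∣ f x - f y ∣ ≡ t)
    differences-attained t ((1≤t , t≤) , nm) =
      source P , target P , adjacent P , trans (edge-difference P) (proj₂ covered)
      where
      covered = range-covered t 1≤t t≤ nm
      P = proj₁ covered

  αLabeling : DivisibleGracefulαLabeling Γ d
  αLabeling = record
    { labeling    = labeling
    ; bipartition = record { side = side ; proper = λ {x} {y} → proper {x} {y} }
    -- High labels reverse the order of offsets, so their minimum comes from the largest offset.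
    ; separated   = true , cap true , e ∸ cap false
        , ((top true , side-top true , f-top true) , λ x s →
            subst (λ b → label b (offset x) ≤ cap true) (sym s) (below x s))
        , ((top false , side-top false , f-top false) , λ x s →
            subst (λ b → e ∸ cap false ≤ label b (offset x)) (sym s) (∸-monoʳ-≤ e (below x s)))
        , low<high (cap true) (cap false) (opposite-caps true)
    }
    where
    below : ∀ x {b} → side x ≡ b → offset x ≤ cap b
    below x s = subst (λ b → offset x ≤ cap b) s (offset-≤ x)
    proper : ∀ {x y} → Adj Γ x y → side x ≢ side y
    proper {x} {y} a s = [ (λ xy → not-¬ {side x} refl (trans s (side-arc {x} {y} xy)))
                         , (λ yx → not-¬ {side y} refl (trans (sym s) (side-arc {y} {x} yx))) ]′
                         (adj⇒arc {x} {y} a)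

theorem3p4 : (k m : ℕ) (1≤k : 1 ≤ k) → 2 ≤ m →
    DivisibleGracefulαLabeling (cycle (4 * k) (3≤4*k 1≤k) □ path m) (4 * (2 * m ∸ 1))
theorem3p4 k (suc M) 1≤k _ =
  -- `e` is the largest permitted label. The construction knows it only through `suc e`, so the
  -- truncated subtraction is resolved here.
  Labelling.αLabeling k M d (d * (k + 1) ∸ 1) {{>-nonZero 1≤k}} (3≤4*k 1≤k) d≡
    (suc-pred (d * (k + 1)) {{m*n≢0 d (k + 1) {{d≢0}} {{>-nonZero (m≤n+m 1 k)}}}})
  where
  d = 4 * (2 * suc M ∸ 1)
  d≡ : d ≡ 4 * suc (M + M)
  d≡ = cong (4 *_) (trans (+-suc M (M + 0)) (cong (λ z → suc (M + z)) (+-identityʳ M)))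
  d≢0 : NonZero d
  d≢0 = subst NonZero (sym d≡) _
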